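{- Let $p(n)$ denote the number of integer partitions of $n$, and let $(a(n))_{n\ge1}$ be the sequence (OEIS A305841) defined by the formal power series identity $$\prod_{n \geq 1}(1+x^n)^{a(n)} = \prod_{n\geq 1} (1-x^n)^{ -p(n)}.$$ For $n\ge 1$ let $A(n)$ be the number of types of $n$ having a single multiplicity, which is a power of $2$. Then $A(n)=a(n)$ for all $n\ge1$.
   Context: A type of $n$ is a sequence $\tau=(\tau|^1,\tau|^2,\dots)$ of (possibly empty) integer partitions with $\sum_{i\ge1} i\,|\tau|^i|=n$, where $|\tau|^i|$ is the size of the partition $\tau|^i$; the multiplicities of $\tau$ are the indices $i$ with $\tau|^i$ nonempty. Thus $A(n)$ counts types $\tau$ of $n$ for which there is exactly one $i$ with $\tau|^i\neq\varnothing$, and this $i$ equals $2^k$ for some $k\ge 0$. Equivalently, $A(n)=p(n)+p(n/2)+p(n/4)+\cdots$, where $p(m)=0$ whenever $m$ is not a non-negative integer. -}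

module Defs where

open import Algebra.Bundles using (RawRing)
import Algebra.Definitions.RawMonoid as RawMonoidDefs
import Algebra.Definitions.RawSemiring as RawSemiringDefs
open import Data.Fin.Base using (Fin; toℕ)
open import Data.Integer.Base as ℤ using (ℤ; +_; -[1+_])
open import Data.List.Base using (List; [])
open import Data.List.Relation.Unary.All using (All)
open import Data.List.Relation.Unary.Linked using (Linked)
open import Data.Nat.Base as ℕ using (ℕ; zero; suc; _≤_; _<_; _≥_; _∸_)
open import Data.Nat.ListAction using (sum)
open import Data.Product using (Σ; ∃; ∃!; _×_; _,_; proj₁)
open import Function.Base using (_∘_)
open import Function.Bundles using (Inverse)
open import Level using (0ℓ)
open import Relation.Binary.Bundles using (Setoid)
import Relation.Binary.Construct.On as On
open import Relation.Binary.PropositionalEquality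
  using (_≡_; _≢_; _≗_; setoid; _→-setoid_)

infix 4 _HasCardinality_ _EventuallyEquals_

_HasCardinality_ : Setoid 0ℓ 0ℓ → ℕ → Set
S HasCardinality k = Inverse S (setoid (Fin k))

-- Convergence of a sequence in the discrete topology.
_EventuallyEquals_ : {A : Set} → (ℕ → A) → A → Set
s EventuallyEquals v = ∃ λ N → ∀ k → N ≤ k → s k ≡ v

record Partition : Set where
  field
    parts      : List ℕ
    decreasing : Linked _≥_ parts
    positive   : All (0 <_) parts

  size : ℕ
  size = sum parts

open Partition public

partitionsOf : ℕ → Setoid 0ℓ 0ℓ
partitionsOf n = record
  { Carrier       = Σ Partition λ π → size π ≡ n
  ; isEquivalence = On.isEquivalence (parts ∘ proj₁) (Setoid.isEquivalence (setoid (List ℕ)))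
  }

open RawMonoidDefs ℕ.+-0-rawMonoid using () renaming (sum to sumℕ)

-- The sequence (τ|¹, τ|², …) is indexed from 0: component j is τ|^(j+1).
-- The partial sums of Σ i |τ|ⁱ| are eventually constant exactly when all but
-- finitely many components are empty.
record Type (n : ℕ) : Set where
  field
    component : ℕ → Partition
    total     : (λ k → sumℕ {k} λ j → suc (toℕ j) ℕ.* size (component (toℕ j)))
                EventuallyEquals n

open Type public

IsMultiplicity : ∀ {n} → Type n → ℕ → Set
IsMultiplicity τ i = ∃ λ j → i ≡ suc j × parts (component τ j) ≢ []

SingleMultiplicityPowerOf2 : ∀ {n} → Type n → Set
SingleMultiplicityPowerOf2 τ =
  Σ (∃! _≡_ (IsMultiplicity τ)) λ (i , _) → ∃ λ k → i ≡ 2 ℕ.^ k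

-- Equality compares the components only, not the witnesses.
singleMultiplicityPowerOf2Types : ℕ → Setoid 0ℓ 0ℓ
singleMultiplicityPowerOf2Types n = record
  { Carrier       = Σ (Type n) SingleMultiplicityPowerOf2
  ; isEquivalence = On.isEquivalence (λ (τ , _) → parts ∘ component τ)
                                     (Setoid.isEquivalence (ℕ →-setoid List ℕ))
  }

Series : Set
Series = ℕ → ℤ

open RawMonoidDefs ℤ.+-0-rawMonoid using () renaming (sum to sumℤ)

rawRing : RawRing 0ℓ 0ℓ
rawRing = record
  { Carrier = Series
  ; _≈_     = _≗_
  ; _+_     = λ f g n → f n ℤ.+ g n
  ; _*_     = λ f g n → sumℤ {suc n} λ i → f (toℕ i) ℤ.* g (n ∸ toℕ i)
  ; -_      = λ f n → ℤ.- f n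
  ; 0#      = λ _ → ℤ.0ℤ
  ; 1#      = λ { zero → ℤ.1ℤ ; (suc _) → ℤ.0ℤ }
  }

open RawRing rawRing using (_+_; -_; 1#)
open RawSemiringDefs (RawRing.rawSemiring rawRing) using (_^_; product)

X : Series
X 1 = ℤ.1ℤ
X _ = ℤ.0ℤ

infixl 6 _-_
_-_ : Series → Series → Series
f - g = f + (- g)

-- Inverse of a series with constant term 1, as the geometric series
-- Σ_k (1 - f)^k. The terms with k > n do not contribute to the coefficient
-- of xⁿ. Junk when the constant term is not 1.
infix 9 _⁻¹
_⁻¹ : Series → Series
(f ⁻¹) n = sumℤ {suc n} λ k → ((1# - f) ^ toℕ k) n

-- Integer powers of a series with constant term 1.
infixr 8 _^ᶻ_
_^ᶻ_ : Series → ℤ → Series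
f ^ᶻ (+ n)    = f ^ n
f ^ᶻ -[1+ n ] = (f ⁻¹) ^ suc n

-- ∏_{n ≥ 1} F n converges to P, coefficient by coefficient.
HasProduct : (ℕ → Series) → Series → Set
HasProduct F P =
  ∀ m → (λ k → product {k} (λ j → F (suc (toℕ j))) m) EventuallyEquals P m

-- ∏_{n ≥ 1} (1 + xⁿ)^(a n) = ∏_{n ≥ 1} (1 - xⁿ)^(- p n).
ProductIdentity : (p : ℕ → ℕ) (a : ℕ → ℤ) → Set
ProductIdentity p a = ∃ λ P →
    HasProduct (λ n → (1# + X ^ n) ^ᶻ a n) P
  × HasProduct (λ n → (1# - X ^ n) ^ᶻ (ℤ.- (+ p n))) P

{-# OPTIONS --safe #-}
module Submission where

-- For d ≥ 1 put L(d) = ∏ⱼ (1 - x^(dj))^(- p j) and R(d) = ∏ⱼ (1 + x^(dj))^(A j).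
-- Since (1 - y)⁻¹ = (1 + y)(1 - y²)⁻¹, we have L(d) = G(d) L(2d) with
-- G(d) = ∏ⱼ (1 + x^(dj))^(p j). Removing the multiplicity 1, or halving a
-- multiplicity 2ᵏ with k ≥ 1, gives A(2m) = p(2m) + A(m) and A(2m+1) = p(2m+1),
-- so R(d) = G(d) R(2d) as well. Modulo x^(N+1) both products are 1 once d > N,
-- hence L(1) = R(1). The exponents are determined by the product because
-- (1 + xⁿ)^a has coefficient a at xⁿ and agrees with 1 below it.

open import Algebra.Bundles using (CommutativeMonoid; CommutativeRing; RawRing)
import Algebra.Definitions.RawMonoid as RawMonoidDefs
import Algebra.Definitions.RawSemiring as RawSemiringDefs
import Algebra.Properties.CommutativeMonoid.Sum as SumProperties
import Algebra.Properties.CommutativeSemigroup as CommutativeSemigroupProperties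
import Algebra.Properties.CommutativeSemiring.Exp as ExpProperties
import Algebra.Properties.Ring as RingProperties
import Algebra.Properties.Semiring.Sum as SemiringSum
open import Data.Bool.Base using (if_then_else_)
open import Data.Bool.Properties using (if-float)
open import Data.Fin.Base as Fin using (Fin; toℕ)
open import Data.Fin.Permutation using (↔⇒≡)
open import Data.Fin.Properties using (+↔⊎)
open import Data.Integer.Base as ℤ using (ℤ; +_; -[1+_])
import Data.Integer.Properties as ℤ
open import Data.Integer.Tactic.RingSolver using (solve-∀)
open import Data.List.Base using (List; []; _∷_)
open import Data.List.Relation.Unary.All using ([])
open import Data.List.Relation.Unary.Linked using ([])
open import Data.Nat.Base as ℕ using (ℕ; zero; suc; _≤_; _<_; z≤n; s≤s)
open import Data.Nat.Induction using (<-rec)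
open import Data.Nat.ListAction using (sum)
open import Data.Nat.Logarithm using (⌊log₂_⌋; ⌊log₂[2^n]⌋≡n)
import Data.Nat.Properties as ℕ
open import Data.Product.Base using (∃; _×_; _,_; proj₁; proj₂)
open import Data.Sum.Base using (inj₁; inj₂)
open import Data.Sum.Function.Setoid using (_⊎-inverse_)
open import Data.Sum.Relation.Binary.Pointwise using (_⊎ₛ_; inj₁; inj₂; Pointwise-≡↔≡)
open import Function.Base using (_∘_; case_of_)
open import Function.Bundles using (Func; Inverse)
import Function.Consequences.Setoid as Consequences
open import Function.Construct.Composition using () renaming (inverse to ↔-trans)
open import Function.Construct.Symmetry using () renaming (inverse to ↔-sym)
open import Level using (0ℓ)
open import Relation.Binary.Bundles using (Setoid)
import Relation.Binary.Construct.On as On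
open import Relation.Binary.PropositionalEquality as ≡ using (_≡_; _≢_; _≗_)
import Relation.Binary.Reasoning.Setoid as SetoidReasoning
open import Relation.Nullary.Decidable using (does; yes; no; dec-true; dec-false)
open import Relation.Nullary.Negation using (contradiction)

-- Finite products in a commutative monoid.

module CommutativeMonoidProducts {c ℓ} (M : CommutativeMonoid c ℓ) where

  open CommutativeMonoid M
  open CommutativeSemigroupProperties commutativeSemigroup using (interchange)
  open SumProperties M using () renaming (sum to product)
  open SetoidReasoning setoid

  Π : (ℕ → Carrier) → ℕ → Carrier
  Π F K = product {K} λ j → F (toℕ j)

  Π-cong : ∀ {F G} K → (∀ {j} → j < K → F j ≈ G j) → Π F K ≈ Π G K
  Π-cong zero    F≈G = refl
  Π-cong (suc K) F≈G = ∙-cong (F≈G (s≤s z≤n)) (Π-cong K λ j<K → F≈G (s≤s j<K))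

  Π-∙ : ∀ F G K → Π (λ j → F j ∙ G j) K ≈ Π F K ∙ Π G K
  Π-∙ F G K = SumProperties.∑-distrib-+ M {K} (F ∘ toℕ) (G ∘ toℕ)

  Π-last : ∀ F K → Π F (suc K) ≈ Π F K ∙ F K
  Π-last F zero    = comm _ _
  Π-last F (suc K) = trans (∙-congˡ (Π-last (F ∘ suc) K)) (sym (assoc _ _ _))

  Π-ε : ∀ {F} K → (∀ j → F j ≈ ε) → Π F K ≈ ε
  Π-ε zero    F≈ε = refl
  Π-ε (suc K) F≈ε = trans (∙-cong (F≈ε 0) (Π-ε K (F≈ε ∘ suc))) (identityˡ ε)

  Π-stable : ∀ {F M K} → M ≤ K → (∀ j → M ≤ j → F j ≈ ε) → Π F K ≈ Π F M
  Π-stable {K = K} z≤n       F≈ε = Π-ε K λ j → F≈ε j z≤n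
  Π-stable         (s≤s M≤K) F≈ε = ∙-congˡ (Π-stable M≤K λ j M≤j → F≈ε (suc j) (s≤s M≤j))

  -- In the applications position `j` carries the factor of index `j + 1`, so the odd positions,
  -- which receive the extra factors `H`, are those of even index.
  Π-interleave : ∀ F G H K →
    (∀ i → F (2 ℕ.* i) ≈ G (2 ℕ.* i)) →
    (∀ i → F (suc (2 ℕ.* i)) ≈ G (suc (2 ℕ.* i)) ∙ H i) →
    Π F (2 ℕ.* K) ≈ Π G (2 ℕ.* K) ∙ Π H K
  Π-interleave F G H zero    even odd = sym (identityˡ ε)
  -- The rewrite brings the length to the form `2 + 2 * K`, so that two factors split off.
  Π-interleave F G H (suc K) even odd rewrite ℕ.+-suc K (K ℕ.+ 0) = begin
    F 0 ∙ (F 1 ∙ Π (λ j → F (2 ℕ.+ j)) (2 ℕ.* K))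
      ≈⟨ ∙-cong (even 0) (∙-cong (odd 0) rest) ⟩
    G 0 ∙ ((G 1 ∙ H 0) ∙ (Π (λ j → G (2 ℕ.+ j)) (2 ℕ.* K) ∙ Π (H ∘ suc) K))
      ≈⟨ ∙-congˡ (interchange _ _ _ _) ⟩
    G 0 ∙ ((G 1 ∙ Π (λ j → G (2 ℕ.+ j)) (2 ℕ.* K)) ∙ (H 0 ∙ Π (H ∘ suc) K))
      ≈⟨ assoc _ _ _ ⟨
    (G 0 ∙ (G 1 ∙ Π (λ j → G (2 ℕ.+ j)) (2 ℕ.* K))) ∙ (H 0 ∙ Π (H ∘ suc) K) ∎
    where
    rest : Π (λ j → F (2 ℕ.+ j)) (2 ℕ.* K) ≈
           Π (λ j → G (2 ℕ.+ j)) (2 ℕ.* K) ∙ Π (H ∘ suc) K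
    rest = Π-interleave (λ j → F (2 ℕ.+ j)) (λ j → G (2 ℕ.+ j)) (H ∘ suc) K
      (λ i → ≡.subst (λ n → F n ≈ G n) (ℕ.*-suc 2 i) (even (suc i)))
      (λ i → ≡.subst (λ n → F (suc n) ≈ G (suc n) ∙ H (suc i)) (ℕ.*-suc 2 i) (odd (suc i)))

-- Inverses in a commutative ring.

module CommutativeRingInverses {c ℓ} (R : CommutativeRing c ℓ) where

  open CommutativeRing R hiding (_-_)
  open RingProperties ring using (+-cancelˡ; -‿distribˡ-*)
  open SetoidReasoning setoid

  inverse-unique : ∀ x {y z} → x * y ≈ 1# → x * z ≈ 1# → y ≈ z
  inverse-unique x {y} {z} xy≈1 xz≈1 = begin
    y           ≈⟨ *-identityʳ y ⟨
    y * 1#      ≈⟨ *-congˡ xz≈1 ⟨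
    y * (x * z) ≈⟨ *-assoc y x z ⟨
    (y * x) * z ≈⟨ *-congʳ (trans (*-comm y x) xy≈1) ⟩
    1# * z      ≈⟨ *-identityˡ z ⟩
    z           ∎

  *-cancelˡ-unit : ∀ x {x′ y z} → x * x′ ≈ 1# → x * y ≈ x * z → y ≈ z
  *-cancelˡ-unit x {x′} {y} {z} xx′≈1 xy≈xz = begin
    y             ≈⟨ undo y ⟨
    x′ * (x * y)  ≈⟨ *-congˡ xy≈xz ⟩
    x′ * (x * z)  ≈⟨ undo z ⟩
    z             ∎
    where
    undo : ∀ u → x′ * (x * u) ≈ u
    undo u = begin
      x′ * (x * u) ≈⟨ *-assoc x′ x u ⟨
      (x′ * x) * u ≈⟨ *-congʳ (trans (*-comm x′ x) xx′≈1) ⟩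
      1# * u       ≈⟨ *-identityˡ u ⟩
      u            ∎

  -- The hypothesis is the fixed-point equation of the geometric series in `1 - x`. It gives `y + x
  -- * y = 1 + ((1 - x) + x) * y = 1 + y`, and `y` cancels.
  geometric-inverse : ∀ x y → y ≈ 1# + (1# + - x) * y → x * y ≈ 1#
  geometric-inverse x y y-fixed = +-cancelˡ y (x * y) 1# (begin
    y + x * y                       ≈⟨ +-congʳ y-fixed ⟩
    1# + (1# + - x) * y + x * y     ≈⟨ +-assoc _ _ _ ⟩
    1# + ((1# + - x) * y + x * y)   ≈⟨ +-congˡ (distribʳ y (1# + - x) x) ⟨
    1# + (1# + - x + x) * y         ≈⟨ +-congˡ (*-congʳ (+-assoc 1# (- x) x)) ⟩
    1# + (1# + (- x + x)) * y       ≈⟨ +-congˡ (*-congʳ (+-congˡ (-‿inverseˡ x))) ⟩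
    1# + (1# + 0#) * y              ≈⟨ +-congˡ (*-congʳ (+-identityʳ 1#)) ⟩
    1# + 1# * y                     ≈⟨ +-congˡ (*-identityˡ y) ⟩
    1# + y                          ≈⟨ +-comm 1# y ⟩
    y + 1#                          ∎)

  difference-of-squares : ∀ x → (1# + - x) * (1# + x) ≈ 1# + - (x * x)
  difference-of-squares x = begin
    (1# + - x) * (1# + x)               ≈⟨ distribʳ (1# + x) 1# (- x) ⟩
    1# * (1# + x) + - x * (1# + x)      ≈⟨ +-cong (*-identityˡ _) (distribˡ (- x) 1# x) ⟩
    (1# + x) + (- x * 1# + - x * x)     ≈⟨ +-congˡ (+-cong (*-identityʳ (- x)) (sym (-‿distribˡ-* x x))) ⟩
    (1# + x) + (- x + - (x * x))        ≈⟨ +-assoc 1# x _ ⟩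
    1# + (x + (- x + - (x * x)))        ≈⟨ +-congˡ (+-assoc x (- x) _) ⟨
    1# + ((x + - x) + - (x * x))        ≈⟨ +-congˡ (+-congʳ (-‿inverseʳ x)) ⟩
    1# + (0# + - (x * x))               ≈⟨ +-congˡ (+-identityˡ _) ⟩
    1# + - (x * x)                      ∎

  -- This is `(1 - x)⁻¹ = (1 + x)(1 - x²)⁻¹`, phrased with given inverses because a ring has no
  -- total inversion.
  inverse-of-square : ∀ x {y z} → (1# + - x) * y ≈ 1# → (1# + - (x * x)) * z ≈ 1# →
                      y ≈ (1# + x) * z
  inverse-of-square x {y} {z} y-inv z-inv = inverse-unique (1# + - x) y-inv (begin
    (1# + - x) * ((1# + x) * z) ≈⟨ *-assoc _ _ _ ⟨
    (1# + - x) * (1# + x) * z   ≈⟨ *-congʳ (difference-of-squares x) ⟩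
    (1# + - (x * x)) * z        ≈⟨ z-inv ⟩
    1#                          ∎)

open ≡ using (refl; sym; trans; cong; cong₂; subst; module ≡-Reasoning)
open import Defs

open RawRing rawRing using (_+_; _*_; -_; 0#; 1#)
open RawSemiringDefs (RawRing.rawSemiring rawRing) using (_^_) renaming (sum to sumˢ)
open RawMonoidDefs ℤ.+-0-rawMonoid using () renaming (sum to sumℤ)

-- Truncated power series

-- The convolution sum unfolds definitionally to
-- (f * g) (suc n) = f 0 * g (suc n) + (tail f * g) n.
tail : Series → Series
tail f n = f (suc n)

-- Congruence modulo `x^(N+1)`. Being a record, it lets unification recover `f`, `N` and `g` from
-- the type.
infix 4 _≈[_]_
record _≈[_]_ (f : Series) (N : ℕ) (g : Series) : Set where
  constructor upTo
  field
    at : ∀ {m} → m ≤ N → f m ≡ g m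

open _≈[_]_

≈-tail : ∀ {f g N} → f ≈[ suc N ] g → tail f ≈[ N ] tail g
≈-tail f≈g = upTo λ m≤N → at f≈g (s≤s m≤N)

≈-weaken : ∀ {f g M N} → M ≤ N → f ≈[ N ] g → f ≈[ M ] g
≈-weaken M≤N f≈g = upTo λ m≤M → at f≈g (ℕ.≤-trans m≤M M≤N)

*-cong-at : ∀ {f f′ g g′} N → f ≈[ N ] f′ → g ≈[ N ] g′ → (f * g) N ≡ (f′ * g′) N
*-cong-at zero    f≈f′ g≈g′ = cong (ℤ._+ ℤ.0ℤ) (cong₂ ℤ._*_ (at f≈f′ z≤n) (at g≈g′ z≤n))
*-cong-at (suc N) f≈f′ g≈g′ =
  cong₂ ℤ._+_ (cong₂ ℤ._*_ (at f≈f′ z≤n) (at g≈g′ ℕ.≤-refl))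
              (*-cong-at N (≈-tail f≈f′) (≈-weaken (ℕ.n≤1+n N) g≈g′))

*-zeroˡ : ∀ g → 0# * g ≗ 0#
*-zeroˡ g zero    = refl
*-zeroˡ g (suc n) = trans (ℤ.+-identityˡ _) (*-zeroˡ g n)

*-identityˡ : ∀ g → 1# * g ≗ g
*-identityˡ g zero    = trans (ℤ.+-identityʳ _) (ℤ.*-identityˡ _)
*-identityˡ g (suc n) =
  trans (cong₂ ℤ._+_ (ℤ.*-identityˡ (g (suc n))) (*-zeroˡ g n)) (ℤ.+-identityʳ _)

*-distribʳ-+ : ∀ h f g → (f + g) * h ≗ f * h + g * h
*-distribʳ-+ h f g zero    = lemma (f 0) (g 0) (h 0)
  where
  lemma : ∀ a b c → (a ℤ.+ b) ℤ.* c ℤ.+ ℤ.0ℤ ≡ (a ℤ.* c ℤ.+ ℤ.0ℤ) ℤ.+ (b ℤ.* c ℤ.+ ℤ.0ℤ)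
  lemma = solve-∀
*-distribʳ-+ h f g (suc n) =
  trans (cong₂ ℤ._+_ {x = (f 0 ℤ.+ g 0) ℤ.* h (suc n)} refl (*-distribʳ-+ h (tail f) (tail g) n))
        (lemma (f 0) (g 0) (h (suc n)) _ _)
  where
  lemma : ∀ a b c u v →
    (a ℤ.+ b) ℤ.* c ℤ.+ (u ℤ.+ v) ≡ (a ℤ.* c ℤ.+ u) ℤ.+ (b ℤ.* c ℤ.+ v)
  lemma = solve-∀

infixr 7 _·_
_·_ : ℤ → Series → Series
(c · f) n = c ℤ.* f n

·-*-assoc : ∀ c f g → (c · f) * g ≗ c · (f * g)
·-*-assoc c f g zero    = lemma c (f 0) (g 0)
  where
  lemma : ∀ a b c → (a ℤ.* b) ℤ.* c ℤ.+ ℤ.0ℤ ≡ a ℤ.* (b ℤ.* c ℤ.+ ℤ.0ℤ)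
  lemma = solve-∀
·-*-assoc c f g (suc n) =
  trans (cong₂ ℤ._+_ {x = (c ℤ.* f 0) ℤ.* g (suc n)} refl (·-*-assoc c (tail f) g n))
        (lemma c (f 0) (g (suc n)) _)
  where
  lemma : ∀ a b c u → (a ℤ.* b) ℤ.* c ℤ.+ a ℤ.* u ≡ a ℤ.* (b ℤ.* c ℤ.+ u)
  lemma = solve-∀

*-assoc : ∀ f g h → (f * g) * h ≗ f * (g * h)
*-assoc f g h zero    = lemma (f 0) (g 0) (h 0)
  where
  lemma : ∀ a b c →
    (a ℤ.* b ℤ.+ ℤ.0ℤ) ℤ.* c ℤ.+ ℤ.0ℤ ≡ a ℤ.* (b ℤ.* c ℤ.+ ℤ.0ℤ) ℤ.+ ℤ.0ℤ
  lemma = solve-∀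
*-assoc f g h (suc n) = begin
  -- By definition `tail (f * g)` is `f 0 · tail g + tail f * g`, so the induction runs on the tail
  -- of the first factor.
  (f 0 ℤ.* g 0 ℤ.+ ℤ.0ℤ) ℤ.* h (suc n) ℤ.+ ((f 0 · tail g + tail f * g) * h) n
    ≡⟨ cong (λ u → c ℤ.+ u) (*-distribʳ-+ h (f 0 · tail g) (tail f * g) n) ⟩
  (f 0 ℤ.* g 0 ℤ.+ ℤ.0ℤ) ℤ.* h (suc n) ℤ.+
    (((f 0 · tail g) * h) n ℤ.+ ((tail f * g) * h) n)
    ≡⟨ cong (λ u → c ℤ.+ u) (cong₂ ℤ._+_ (·-*-assoc (f 0) (tail g) h n) (*-assoc (tail f) g h n)) ⟩
  (f 0 ℤ.* g 0 ℤ.+ ℤ.0ℤ) ℤ.* h (suc n) ℤ.+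
    (f 0 ℤ.* (tail g * h) n ℤ.+ (tail f * (g * h)) n)
    ≡⟨ lemma (f 0) (g 0) (h (suc n)) _ _ ⟩
  f 0 ℤ.* (g 0 ℤ.* h (suc n) ℤ.+ (tail g * h) n) ℤ.+ (tail f * (g * h)) n ∎
  where
  open ≡-Reasoning
  c = (f 0 ℤ.* g 0 ℤ.+ ℤ.0ℤ) ℤ.* h (suc n)
  lemma : ∀ a b c u v →
    (a ℤ.* b ℤ.+ ℤ.0ℤ) ℤ.* c ℤ.+ (a ℤ.* u ℤ.+ v) ≡ a ℤ.* (b ℤ.* c ℤ.+ u) ℤ.+ v
  lemma = solve-∀

-- Mirror image of the definitional unfolding: it peels off the term with `g 0` instead of `f 0`,
-- which is what commutativity needs.
*-sucʳ : ∀ f g n → (f * g) (suc n) ≡ f (suc n) ℤ.* g 0 ℤ.+ (f * tail g) n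
*-sucʳ f g zero    = lemma (f 0) (f 1) (g 0) (g 1)
  where
  lemma : ∀ a b c d →
    a ℤ.* d ℤ.+ (b ℤ.* c ℤ.+ ℤ.0ℤ) ≡ b ℤ.* c ℤ.+ (a ℤ.* d ℤ.+ ℤ.0ℤ)
  lemma = solve-∀
*-sucʳ f g (suc n) =
  trans (cong₂ ℤ._+_ {x = f 0 ℤ.* g (suc (suc n))} refl (*-sucʳ (tail f) g n))
        (lemma (f 0 ℤ.* g (suc (suc n))) (f (suc (suc n)) ℤ.* g 0) _)
  where
  lemma : ∀ a b c → a ℤ.+ (b ℤ.+ c) ≡ b ℤ.+ (a ℤ.+ c)
  lemma = solve-∀

*-comm : ∀ f g → f * g ≗ g * f
*-comm f g zero    = cong (ℤ._+ ℤ.0ℤ) (ℤ.*-comm (f 0) (g 0))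
*-comm f g (suc n) =
  trans (cong₂ ℤ._+_ (ℤ.*-comm (f 0) (g (suc n))) (*-comm (tail f) g n))
        (sym (*-sucʳ g f n))

≗⇒≈ : ∀ {f g N} → f ≗ g → f ≈[ N ] g
≗⇒≈ f≗g = upTo λ {m} _ → f≗g m

-- The ring of series modulo `x^(N+1)`, with whole series as representatives. In it almost all
-- factors of the infinite products equal 1, and an exact identity of series follows by reading
-- coefficient `N` for every `N`.
truncatedRing : ℕ → CommutativeRing 0ℓ 0ℓ
truncatedRing N = record
  { Carrier = Series
  ; _≈_ = _≈[ N ]_
  ; _+_ = _+_
  ; _*_ = _*_
  ; -_ = -_
  ; 0# = 0#
  ; 1# = 1#
  ; isCommutativeRing = record
    { isRing = record
      { +-isAbelianGroup = record
        { isGroup = record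
          { isMonoid = record
            { isSemigroup = record
              { isMagma = record
                { isEquivalence = record
                  { refl  = upTo λ _ → refl
                  ; sym   = λ p → upTo λ m≤N → sym (at p m≤N)
                  ; trans = λ p q → upTo λ m≤N → trans (at p m≤N) (at q m≤N)
                  }
                ; ∙-cong = λ p q → upTo λ m≤N → cong₂ ℤ._+_ (at p m≤N) (at q m≤N)
                }
              ; assoc = λ f g h → ≗⇒≈ λ n → ℤ.+-assoc (f n) (g n) (h n)
              }
            ; identity = (λ f → ≗⇒≈ λ n → ℤ.+-identityˡ (f n))
                       , (λ f → ≗⇒≈ λ n → ℤ.+-identityʳ (f n))
            }
          ; inverse = (λ f → ≗⇒≈ λ n → ℤ.+-inverseˡ (f n))
                    , (λ f → ≗⇒≈ λ n → ℤ.+-inverseʳ (f n))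
          ; ⁻¹-cong = λ p → upTo λ m≤N → cong ℤ.-_ (at p m≤N)
          }
        ; comm = λ f g → ≗⇒≈ λ n → ℤ.+-comm (f n) (g n)
        }
      ; *-cong = λ p q → upTo λ {m} m≤N → *-cong-at m (≈-weaken m≤N p) (≈-weaken m≤N q)
      ; *-assoc = λ f g h → ≗⇒≈ (*-assoc f g h)
      ; *-identity = (λ f → ≗⇒≈ (*-identityˡ f))
                   , (λ f → ≗⇒≈ λ n → trans (*-comm f 1# n) (*-identityˡ f n))
      ; distrib = (λ f g h → ≗⇒≈ (*-distribˡ-+ f g h))
                , (λ f g h → ≗⇒≈ (*-distribʳ-+ f g h))
      }
    ; *-comm = λ f g → ≗⇒≈ (*-comm f g)
    }
  }
  where
  *-distribˡ-+ : ∀ f g h → f * (g + h) ≗ f * g + f * h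
  *-distribˡ-+ f g h n = trans (*-comm f (g + h) n)
    (trans (*-distribʳ-+ f g h n) (cong₂ ℤ._+_ (*-comm g f n) (*-comm h f n)))

-- The geometric series as an inverse.

coefficient-sum : ∀ {K} (t : Fin K → Series) n → sumˢ t n ≡ sumℤ λ k → t k n
coefficient-sum {zero}  t n = refl
coefficient-sum {suc K} t n = cong (λ u → t Fin.zero n ℤ.+ u) (coefficient-sum (t ∘ Fin.suc) n)

-- Put `g = 1 - f`. Since `g` has no constant term, each coefficient of the partial sums `S K` of
-- `Σ gᵏ` stabilises, so `f ⁻¹` inherits the recursion `S (K + 1) = 1 + g * S K` as a fixed-point
-- equation.
⁻¹-inverseʳ : ∀ f → f 0 ≡ ℤ.1ℤ → f * f ⁻¹ ≗ 1#
⁻¹-inverseʳ f f₀≡1 N =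
  at (CommutativeRingInverses.geometric-inverse (truncatedRing N) f (f ⁻¹) f⁻¹-fixed) ℕ.≤-refl
  where
  g = 1# - f
  g₀≡0 : g 0 ≡ ℤ.0ℤ
  g₀≡0 = cong (λ c → ℤ.1ℤ ℤ.+ ℤ.- c) f₀≡1
  S : ℕ → Series
  S K = sumˢ {K} λ k → g ^ toℕ k
  S-suc : ∀ K → S (suc K) ≗ 1# + g * S K
  S-suc K n = cong (λ u → 1# n ℤ.+ u)
    (sym (at (SemiringSum.*-distribˡ-sum (CommutativeRing.semiring (truncatedRing n))
                {K} g (λ k → g ^ toℕ k)) ℕ.≤-refl))
  -- As `g 0` vanishes, coefficient `m` of `g * h` involves only coefficients of `h` below `m`.
  g*-cong : ∀ {h h′} m → (∀ {i} → i < m → h i ≡ h′ i) → (g * h) m ≡ (g * h′) m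
  g*-cong {h} {h′} zero    h≈h′ rewrite g₀≡0 = refl
  g*-cong {h} {h′} (suc m) h≈h′ rewrite g₀≡0 =
    cong (λ u → ℤ.0ℤ ℤ.+ u) (*-cong-at {tail g} m (upTo λ _ → refl) (upTo λ i≤m → h≈h′ (s≤s i≤m)))
  S-stable : ∀ {m K} → m < K → S (suc K) m ≡ S K m
  S-stable {m} {suc K} (s≤s m≤K) =
    trans (S-suc (suc K) m)
      (trans (cong (λ u → 1# m ℤ.+ u)
                   (g*-cong m λ i<m → S-stable (ℕ.<-≤-trans i<m m≤K)))
             (sym (S-suc K m)))
  -- For `K = m + 1` this is the definition of `⁻¹`; larger `K` reduce to it by stability.
  f⁻¹≡S : ∀ {m K} → m < K → (f ⁻¹) m ≡ S K m
  f⁻¹≡S {m} {suc K} (s≤s m≤K) with ℕ.m≤n⇒m<n∨m≡n m≤K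
  ... | inj₁ m<K  = trans (f⁻¹≡S m<K) (sym (S-stable m<K))
  ... | inj₂ refl = sym (coefficient-sum {suc m} (λ k → g ^ toℕ k) m)
  f⁻¹-fixed : f ⁻¹ ≈[ N ] 1# + g * f ⁻¹
  -- Up to degree `N`, `f ⁻¹` agrees with `S (N + 2)`; peeling off the first term leaves
  -- `g * S (N + 1)`, where `S (N + 1)` again agrees with `f ⁻¹` in the degrees that matter.
  f⁻¹-fixed = upTo λ {m} m≤N →
    trans (f⁻¹≡S (ℕ.m≤n⇒m≤1+n (s≤s m≤N)))
      (trans (S-suc (suc N) m)
             (cong (λ u → 1# m ℤ.+ u)
                   (g*-cong m λ i<m → sym (f⁻¹≡S (ℕ.m≤n⇒m≤1+n (ℕ.<-≤-trans i<m m≤N))))))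

-- The power of Defs is computed in a raw semiring with equality _≗_, so it
-- does not unfold to the power of truncatedRing N on an open exponent.
module Exp (N : ℕ) where

  private
    module E = ExpProperties (CommutativeRing.commutativeSemiring (truncatedRing N))

  ^≡^ : ∀ f n → f ^ n ≡ f E.^ n
  ^≡^ f zero    = refl
  ^≡^ f (suc n) = cong (f *_) (^≡^ f n)

  ^-congˡ : ∀ {f g} n → f ≈[ N ] g → f ^ n ≈[ N ] g ^ n
  ^-congˡ {f} {g} n f≈g rewrite ^≡^ f n | ^≡^ g n = E.^-congˡ n f≈g

  ^-homo-* : ∀ f m n → f ^ (m ℕ.+ n) ≈[ N ] f ^ m * f ^ n
  ^-homo-* f m n rewrite ^≡^ f (m ℕ.+ n) | ^≡^ f m | ^≡^ f n = E.^-homo-* f m n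

  ^-distrib-* : ∀ f g n → (f * g) ^ n ≈[ N ] f ^ n * g ^ n
  ^-distrib-* f g n rewrite ^≡^ (f * g) n | ^≡^ f n | ^≡^ g n = E.^-distrib-* f g n

-- Powers of `X` and factors congruent to 1.

X-*-suc : ∀ f n → (X * f) (suc n) ≡ f n
X-*-suc f n = begin
  ℤ.0ℤ ℤ.* f (suc n) ℤ.+ (tail X * f) n ≡⟨ ℤ.+-identityˡ _ ⟩
  (tail X * f) n                        ≡⟨ *-cong-at {g = f} n tail-X≈1 (upTo λ _ → refl) ⟩
  (1# * f) n                            ≡⟨ *-identityˡ f n ⟩
  f n                                   ∎
  where
  open ≡-Reasoning
  tail-X≈1 : tail X ≈[ n ] 1#
  tail-X≈1 = upTo λ { {zero} _ → refl ; {suc _} _ → refl }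

X^n-below : ∀ {m n} → m < n → (X ^ n) m ≡ ℤ.0ℤ
X^n-below {zero}  {suc n} _         = refl
X^n-below {suc m} {suc n} (s≤s m<n) = trans (X-*-suc (X ^ n) m) (X^n-below m<n)

X^n-at-n : ∀ n → (X ^ n) n ≡ ℤ.1ℤ
X^n-at-n zero    = refl
X^n-at-n (suc n) = trans (X-*-suc (X ^ n) n) (X^n-at-n n)

1+X^n≈1 : ∀ {n N} → N < n → 1# + X ^ n ≈[ N ] 1#
1+X^n≈1 N<n = upTo λ {m} m≤N →
  trans (cong (λ u → 1# m ℤ.+ u) (X^n-below (ℕ.≤-<-trans m≤N N<n))) (ℤ.+-identityʳ _)

1-X^n≈1 : ∀ {n N} → N < n → 1# - X ^ n ≈[ N ] 1#
1-X^n≈1 N<n = upTo λ {m} m≤N →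
  trans (cong (λ u → 1# m ℤ.+ ℤ.- u) (X^n-below (ℕ.≤-<-trans m≤N N<n))) (ℤ.+-identityʳ _)

≈1⇒inverse : ∀ {f N} → f ≈[ N ] 1# → f * f ⁻¹ ≗ 1#
≈1⇒inverse {f} f≈1 = ⁻¹-inverseʳ f (at f≈1 z≤n)

≈1⇒⁻¹≈1 : ∀ {f N} → f ≈[ N ] 1# → f ⁻¹ ≈[ N ] 1#
≈1⇒⁻¹≈1 {f} {N} f≈1 =
  CommutativeRingInverses.inverse-unique (truncatedRing N) f
    (≗⇒≈ (≈1⇒inverse f≈1)) (R.trans (R.*-identityʳ f) f≈1)
  where module R = CommutativeRing (truncatedRing N)

≈1⇒^≈1 : ∀ {f N} n → f ≈[ N ] 1# → f ^ n ≈[ N ] 1#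
≈1⇒^≈1         zero    f≈1 = ≗⇒≈ λ _ → refl
≈1⇒^≈1 {N = N} (suc n) f≈1 = R.trans (R.*-cong f≈1 (≈1⇒^≈1 n f≈1)) (R.*-identityˡ 1#)
  where module R = CommutativeRing (truncatedRing N)

≈1⇒^ᶻ≈1 : ∀ {f N} z → f ≈[ N ] 1# → f ^ᶻ z ≈[ N ] 1#
≈1⇒^ᶻ≈1 (+ n)    f≈1 = ≈1⇒^≈1 n f≈1
≈1⇒^ᶻ≈1 -[1+ n ] f≈1 = ≈1⇒^≈1 (suc n) (≈1⇒⁻¹≈1 f≈1)

-- Leading coefficients.

*-at-order : ∀ f g n → (∀ {i} → i < n → f i ≡ ℤ.0ℤ) → (f * g) n ≡ f n ℤ.* g 0
*-at-order f g zero    f≡0 = ℤ.+-identityʳ _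
*-at-order f g (suc n) f≡0 rewrite f≡0 {0} (s≤s z≤n) =
  trans (ℤ.+-identityˡ _) (*-at-order (tail f) g n λ i<n → f≡0 (s≤s i<n))

-- On series congruent to 1 modulo `x^(n+1)`, taking the coefficient at `x^(n+1)` turns products
-- into sums. Hence inversion negates it and integer powers multiply it by the exponent.
*-leading : ∀ {f g n} → f ≈[ n ] 1# → g ≈[ n ] 1# → (f * g) (suc n) ≡ f (suc n) ℤ.+ g (suc n)
*-leading {f} {g} {n} f≈1 g≈1 = begin
  f 0 ℤ.* g (suc n) ℤ.+ (tail f * g) n
    ≡⟨ cong₂ (λ u v → u ℤ.* g (suc n) ℤ.+ v) (at f≈1 z≤n) (*-at-order (tail f) g n (at f≈1)) ⟩
  ℤ.1ℤ ℤ.* g (suc n) ℤ.+ f (suc n) ℤ.* g 0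
    ≡⟨ cong₂ ℤ._+_ (ℤ.*-identityˡ (g (suc n)))
                   (trans (cong (f (suc n) ℤ.*_) (at g≈1 z≤n)) (ℤ.*-identityʳ (f (suc n)))) ⟩
  g (suc n) ℤ.+ f (suc n)
    ≡⟨ ℤ.+-comm (g (suc n)) (f (suc n)) ⟩
  f (suc n) ℤ.+ g (suc n) ∎
  where open ≡-Reasoning

⁻¹-leading : ∀ {f n} → f ≈[ n ] 1# → (f ⁻¹) (suc n) ≡ ℤ.- f (suc n)
⁻¹-leading {f} {n} f≈1 =
  RingProperties.+-inverseʳ-unique ℤ.+-*-ring (f (suc n)) ((f ⁻¹) (suc n))
    (trans (sym (*-leading f≈1 (≈1⇒⁻¹≈1 f≈1))) (≈1⇒inverse f≈1 (suc n)))

^-leading : ∀ {f n} k → f ≈[ n ] 1# → (f ^ k) (suc n) ≡ + k ℤ.* f (suc n)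
^-leading         zero    f≈1 = refl
^-leading {f} {n} (suc k) f≈1 =
  trans (*-leading f≈1 (≈1⇒^≈1 k f≈1))
    (trans (cong (λ u → f (suc n) ℤ.+ u) (^-leading k f≈1)) (sym (ℤ.suc-* (+ k) (f (suc n)))))

^ᶻ-leading : ∀ {f n} z → f ≈[ n ] 1# → (f ^ᶻ z) (suc n) ≡ z ℤ.* f (suc n)
^ᶻ-leading         (+ k)    f≈1 = ^-leading k f≈1
^ᶻ-leading {f} {n} -[1+ k ] f≈1 = begin
  ((f ⁻¹) ^ suc k) (suc n)   ≡⟨ ^-leading (suc k) (≈1⇒⁻¹≈1 f≈1) ⟩
  + suc k ℤ.* (f ⁻¹) (suc n) ≡⟨ cong (+ suc k ℤ.*_) (⁻¹-leading f≈1) ⟩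
  + suc k ℤ.* ℤ.- f (suc n)  ≡⟨ ℤ.neg-distribʳ-* (+ suc k) (f (suc n)) ⟨
  ℤ.- (+ suc k ℤ.* f (suc n)) ≡⟨ ℤ.neg-distribˡ-* (+ suc k) (f (suc n)) ⟩
  -[1+ k ] ℤ.* f (suc n)     ∎
  where open ≡-Reasoning

-- The case split is needed because `- (+ 0)` reduces to `+ 0`, which selects the nonnegative clause
-- of `^ᶻ`.
^ᶻ-neg : ∀ f k → f ^ᶻ (ℤ.- (+ k)) ≡ (f ⁻¹) ^ k
^ᶻ-neg f zero    = refl
^ᶻ-neg f (suc k) = refl

-- Infinite products

open module Products {N} =
  CommutativeMonoidProducts (CommutativeRing.*-commutativeMonoid (truncatedRing N))
  hiding (Π)
-- Only the equality depends on the truncation order, not the product itself; fixing order 0 here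
-- gives one `Π` for all orders.
Π : (ℕ → Series) → ℕ → Series
Π = CommutativeMonoidProducts.Π (CommutativeRing.*-commutativeMonoid (truncatedRing 0))

-- Factors of index above `N` are 1 modulo `x^(N+1)`, so the first `N` factors already determine the
-- limit to that order.
HasProduct⇒Π≈ : ∀ F {P} → (∀ j → F (suc j) ≈[ j ] 1#) → HasProduct F P →
                ∀ N → Π (F ∘ suc) N ≈[ N ] P
HasProduct⇒Π≈ F F≈1 F→P N = upTo λ {m} m≤N →
  let (K , stable) = F→P m
      -- Far enough both for coefficient `m` to have reached its limit and for the product to extend
      -- the first `N` factors.
      L = K ℕ.⊔ N
  in trans (sym (at (Π-stable {F = F ∘ suc} (ℕ.m≤n⊔m K N) (λ j N≤j → ≈-weaken N≤j (F≈1 j))) m≤N))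
           (stable L (ℕ.m≤m⊔n K N))

Π≈⇒HasProduct : ∀ F {P} → (∀ j → F (suc j) ≈[ j ] 1#) →
                (∀ N → Π (F ∘ suc) N ≈[ N ] P) → HasProduct F P
Π≈⇒HasProduct F F≈1 Π≈P m = m , λ k m≤k →
  trans (at (Π-stable {F = F ∘ suc} m≤k (λ j m≤j → ≈-weaken m≤j (F≈1 j))) ℕ.≤-refl)
        (at (Π≈P m) ℕ.≤-refl)

-- Uniqueness of the exponents.

binomialFactor : (ℕ → ℤ) → ℕ → Series
binomialFactor a n = (1# + X ^ n) ^ᶻ a n

binomialFactor≈1 : ∀ a j → binomialFactor a (suc j) ≈[ j ] 1#
binomialFactor≈1 a j = ≈1⇒^ᶻ≈1 (a (suc j)) (1+X^n≈1 ℕ.≤-refl)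

binomialFactor-leading : ∀ a j → binomialFactor a (suc j) (suc j) ≡ a (suc j)
binomialFactor-leading a j =
  trans (^ᶻ-leading (a (suc j)) (1+X^n≈1 ℕ.≤-refl))
    (trans (cong (λ u → a (suc j) ℤ.* (ℤ.0ℤ ℤ.+ u)) (X^n-at-n (suc j))) (ℤ.*-identityʳ _))

-- Strong induction: modulo `x^(n+2)` the first `n` factors agree and cancel, and the coefficient of
-- the remaining factor at `x^(n+1)` is its exponent.
exponents-unique : ∀ a b →
  (∀ N → Π (binomialFactor a ∘ suc) N ≈[ N ] Π (binomialFactor b ∘ suc) N) →
  ∀ n → a (suc n) ≡ b (suc n)
exponents-unique a b Πa≈Πb = <-rec _ step
  where
  step : ∀ n → (∀ {j} → j < n → a (suc j) ≡ b (suc j)) → a (suc n) ≡ b (suc n)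
  step n a≡b = begin
    a (suc n)                         ≡⟨ binomialFactor-leading a n ⟨
    binomialFactor a (suc n) (suc n)  ≡⟨ at (*-cancelˡ-unit U (≗⇒≈ U-inv) lastFactors) ℕ.≤-refl ⟩
    binomialFactor b (suc n) (suc n)  ≡⟨ binomialFactor-leading b n ⟩
    b (suc n)                         ∎
    where
    open ≡-Reasoning
    open CommutativeRingInverses (truncatedRing (suc n)) using (*-cancelˡ-unit)
    module R = CommutativeRing (truncatedRing (suc n))
    U = Π (binomialFactor a ∘ suc) n
    -- Modulo `x` every factor is 1, so `U` has constant term 1 and is a unit.
    U-inv : U * U ⁻¹ ≗ 1#
    U-inv = ≈1⇒inverse (Π-stable {0} {F = binomialFactor a ∘ suc} {0} {n} z≤n
                                 λ j _ → ≈-weaken z≤n (binomialFactor≈1 a j))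
    Πb≈U : Π (binomialFactor b ∘ suc) n ≈[ suc n ] U
    Πb≈U = Π-cong n λ {j} j<n → R.reflexive
      (cong ((1# + X ^ suc j) ^ᶻ_) (sym (a≡b j<n)))
    lastFactors : U * binomialFactor a (suc n) ≈[ suc n ] U * binomialFactor b (suc n)
    lastFactors = R.trans (R.sym (Π-last (binomialFactor a ∘ suc) n))
      (R.trans (Πa≈Πb (suc n))
        (R.trans (Π-last (binomialFactor b ∘ suc) n) (R.*-congʳ Πb≈U)))

-- The doubling recursion for both products.

module DoublingIdentity
  (p A : ℕ → ℕ)
  (A-odd  : ∀ i → A (suc (2 ℕ.* i)) ≡ p (suc (2 ℕ.* i)))
  (A-even : ∀ i → A (2 ℕ.+ 2 ℕ.* i) ≡ p (2 ℕ.+ 2 ℕ.* i) ℕ.+ A (suc i))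
  where

  -- Factors of `L(d)`, `R(d)` and `G(d)`, in this order; argument `j` stands for index `j + 1`.
  left right middle : ℕ → ℕ → Series
  left   d j = (1# - X ^ (d ℕ.* suc j)) ^ᶻ (ℤ.- (+ p (suc j)))
  right  d j = (1# + X ^ (d ℕ.* suc j)) ^ A (suc j)
  middle d j = (1# + X ^ (d ℕ.* suc j)) ^ p (suc j)

  module _ (N : ℕ) where
    module R = CommutativeRing (truncatedRing N)
    open CommutativeRingInverses (truncatedRing N) using (inverse-of-square)
    open Exp N
    open SetoidReasoning R.setoid

    left-doubling : ∀ d j → 1 ≤ d → left d j ≈[ N ] middle d j * left (2 ℕ.* d) j
    left-doubling d j 1≤d = begin
      left d j                                        ≡⟨ ^ᶻ-neg (1# - x) (p (suc j)) ⟩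
      ((1# - x) ⁻¹) ^ p (suc j)
        ≈⟨ ^-congˡ (p (suc j))
             (inverse-of-square x (≗⇒≈ (≈1⇒inverse (1-X^n≈1 0<dj))) square-inverse) ⟩
      ((1# + x) * (1# - x²) ⁻¹) ^ p (suc j)           ≈⟨ ^-distrib-* (1# + x) ((1# - x²) ⁻¹) (p (suc j)) ⟩
      middle d j * ((1# - x²) ⁻¹) ^ p (suc j)         ≡⟨ cong (middle d j *_) (^ᶻ-neg (1# - x²) (p (suc j))) ⟨
      middle d j * left (2 ℕ.* d) j                   ∎
      where
      x = X ^ (d ℕ.* suc j)
      x² = X ^ (2 ℕ.* d ℕ.* suc j)
      0<dj : 0 < d ℕ.* suc j
      0<dj = ℕ.*-mono-≤ 1≤d (s≤s z≤n)
      0<2dj : 0 < 2 ℕ.* d ℕ.* suc j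
      0<2dj = ℕ.*-mono-≤ (ℕ.*-mono-≤ {1} {2} (s≤s z≤n) 1≤d) (s≤s z≤n)
      square : x * x ≈[ N ] x²
      square = R.trans (R.sym (^-homo-* X (d ℕ.* suc j) (d ℕ.* suc j)))
        (R.reflexive (cong (X ^_) (trans (cong (d ℕ.* suc j ℕ.+_) (sym (ℕ.+-identityʳ _)))
          (sym (ℕ.*-assoc 2 d (suc j))))))
      square-inverse : (1# - x * x) * (1# - x²) ⁻¹ ≈[ N ] 1#
      square-inverse = R.trans (R.*-congʳ {(1# - x²) ⁻¹} (R.+-congˡ {1#} (R.-‿cong square)))
        (≗⇒≈ (≈1⇒inverse (1-X^n≈1 0<2dj)))

    right-odd : ∀ d i → right d (2 ℕ.* i) ≈[ N ] middle d (2 ℕ.* i)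
    right-odd d i = R.reflexive (cong ((1# + X ^ (d ℕ.* suc (2 ℕ.* i))) ^_) (A-odd i))

    -- The summand `A (i + 1)` of the exponent splits off a power of `1 + x^(d(2i+2))`, which is
    -- exactly factor `i` of `R(2d)`.
    right-even : ∀ d i →
      right d (suc (2 ℕ.* i)) ≈[ N ] middle d (suc (2 ℕ.* i)) * right (2 ℕ.* d) i
    right-even d i = begin
      y ^ A (2 ℕ.+ 2 ℕ.* i)                        ≡⟨ cong (y ^_) (A-even i) ⟩
      y ^ (p (2 ℕ.+ 2 ℕ.* i) ℕ.+ A (suc i))        ≈⟨ ^-homo-* y (p (2 ℕ.+ 2 ℕ.* i)) (A (suc i)) ⟩
      middle d (suc (2 ℕ.* i)) * y ^ A (suc i)
        ≡⟨ cong (λ n → middle d (suc (2 ℕ.* i)) * (1# + X ^ n) ^ A (suc i)) exponent ⟩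
      middle d (suc (2 ℕ.* i)) * right (2 ℕ.* d) i ∎
      where
      y = 1# + X ^ (d ℕ.* (2 ℕ.+ 2 ℕ.* i))
      exponent : d ℕ.* (2 ℕ.+ 2 ℕ.* i) ≡ 2 ℕ.* d ℕ.* suc i
      exponent = trans (cong (d ℕ.*_) (sym (ℕ.*-suc 2 i)))
        (trans (sym (ℕ.*-assoc d 2 (suc i))) (cong (ℕ._* suc i) (ℕ.*-comm d 2)))

    order : ∀ {d j} → 1 ≤ d → N ≤ j → N < d ℕ.* suc j
    order {d} {j} 1≤d N≤j = ℕ.≤-trans (s≤s N≤j)
      (ℕ.≤-trans (ℕ.≤-reflexive (sym (ℕ.*-identityˡ (suc j)))) (ℕ.*-monoˡ-≤ (suc j) 1≤d))

    N≤2N : N ≤ 2 ℕ.* N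
    N≤2N = ℕ.m≤m+n N (N ℕ.+ 0)

    -- Induction on the number `k` of doublings still allowed. When it reaches 0, `d > N` and all
    -- factors on both sides are 1 modulo `x^(N+1)`.
    truncated : ∀ k d → 1 ≤ d → N < k ℕ.+ d → Π (left d) N ≈[ N ] Π (right d) N
    truncated zero d 1≤d N<d = Π-cong N λ {j} _ →
      R.trans (≈1⇒^ᶻ≈1 (ℤ.- (+ p (suc j))) (1-X^n≈1 (N<dj j)))
              (R.sym (≈1⇒^≈1 (A (suc j)) (1+X^n≈1 (N<dj j))))
      where
      N<dj : ∀ j → N < d ℕ.* suc j
      N<dj j = ℕ.<-≤-trans N<d (ℕ.m≤m*n d (suc j))
    truncated (suc k) d 1≤d N<k+d = begin
      Π (left d) N                                   ≈⟨ Π-cong N (λ {j} _ → left-doubling d j 1≤d) ⟩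
      Π (λ j → middle d j * left (2 ℕ.* d) j) N      ≈⟨ Π-∙ (middle d) (left (2 ℕ.* d)) N ⟩
      Π (middle d) N * Π (left (2 ℕ.* d)) N
        -- Interleaving pairs `N` factors of `R(2d)` with `2N` factors of `G(d)`; the added ones are
        -- 1 modulo `x^(N+1)`.
        ≈⟨ R.*-cong (R.sym (Π-stable N≤2N middle-trivial)) (truncated k (2 ℕ.* d) 1≤2d N<k+2d) ⟩
      Π (middle d) (2 ℕ.* N) * Π (right (2 ℕ.* d)) N
        ≈⟨ Π-interleave (right d) (middle d) (right (2 ℕ.* d)) N (right-odd d) (right-even d) ⟨
      Π (right d) (2 ℕ.* N)                          ≈⟨ Π-stable N≤2N right-trivial ⟩
      Π (right d) N                                  ∎
      where
      middle-trivial : ∀ j → N ≤ j → middle d j ≈[ N ] 1#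
      middle-trivial j N≤j = ≈1⇒^≈1 (p (suc j)) (1+X^n≈1 (order 1≤d N≤j))
      right-trivial : ∀ j → N ≤ j → right d j ≈[ N ] 1#
      right-trivial j N≤j = ≈1⇒^≈1 (A (suc j)) (1+X^n≈1 (order 1≤d N≤j))
      1≤2d : 1 ≤ 2 ℕ.* d
      1≤2d = ℕ.≤-trans 1≤d (ℕ.m≤m+n d (d ℕ.+ 0))
      N<k+2d : N < k ℕ.+ 2 ℕ.* d
      -- Since `d ≥ 1`, doubling gains at least the one that `k` loses.
      N<k+2d = ℕ.≤-trans N<k+d (ℕ.≤-trans (ℕ.≤-reflexive (sym (ℕ.+-suc k d)))
        (ℕ.+-monoʳ-≤ k (ℕ.+-mono-≤ 1≤d (ℕ.≤-reflexive (sym (ℕ.+-identityʳ d))))))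

  geometricFactor : ℕ → Series
  geometricFactor n = (1# - X ^ n) ^ᶻ (ℤ.- (+ p n))

  geometricFactor≈1 : ∀ j → geometricFactor (suc j) ≈[ j ] 1#
  geometricFactor≈1 j = ≈1⇒^ᶻ≈1 (ℤ.- (+ p (suc j))) (1-X^n≈1 ℕ.≤-refl)

  Π-geometric≈Π-binomial : ∀ N →
    Π (geometricFactor ∘ suc) N ≈[ N ] Π (binomialFactor (+_ ∘ A) ∘ suc) N
  Π-geometric≈Π-binomial N = R.trans N
    (Π-cong {F = geometricFactor ∘ suc} {left 1} N λ {j} _ → R.reflexive N (left-1 j))
    -- From `d = 1`, `N` doublings suffice because `N < N + 1`.
    (R.trans N (truncated N N 1 ℕ.≤-refl (ℕ.≤-reflexive (ℕ.+-comm 1 N)))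
             (Π-cong {F = right 1} {binomialFactor (+_ ∘ A) ∘ suc} N λ {j} _ → R.reflexive N (right-1 j)))
    where
    left-1 : ∀ j → geometricFactor (suc j) ≡ left 1 j
    left-1 j = cong (λ n → (1# - X ^ n) ^ᶻ (ℤ.- (+ p (suc j)))) (sym (ℕ.*-identityˡ (suc j)))
    right-1 : ∀ j → right 1 j ≡ binomialFactor (+_ ∘ A) (suc j)
    right-1 j = cong (λ n → (1# + X ^ n) ^ A (suc j)) (ℕ.*-identityˡ (suc j))

  productIdentity : ProductIdentity p (+_ ∘ A)
  productIdentity = P
    , Π≈⇒HasProduct (binomialFactor (+_ ∘ A)) (binomialFactor≈1 (+_ ∘ A)) binomial→P
    , Π≈⇒HasProduct geometricFactor geometricFactor≈1 λ N →
        R.trans N (Π-geometric≈Π-binomial N) (binomial→P N)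
    where
    -- The limit is read off diagonally: coefficient `m` no longer changes after `m` factors.
    P : Series
    P m = Π (binomialFactor (+_ ∘ A) ∘ suc) m m
    binomial→P : ∀ N → Π (binomialFactor (+_ ∘ A) ∘ suc) N ≈[ N ] P
    binomial→P N = upTo λ m≤N → at (Π-stable {F = binomialFactor (+_ ∘ A) ∘ suc} m≤N
      λ j m≤j → ≈-weaken m≤j (binomialFactor≈1 (+_ ∘ A) j)) ℕ.≤-refl

  productIdentity-unique : ∀ a → ProductIdentity p a → ∀ n → + A (suc n) ≡ a (suc n)
  productIdentity-unique a (P , binomial→P , geometric→P) = exponents-unique (+_ ∘ A) a λ N →
    R.trans N (R.sym N (Π-geometric≈Π-binomial N))
      (R.trans N (HasProduct⇒Π≈ geometricFactor geometricFactor≈1 geometric→P N)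
        (R.sym N (HasProduct⇒Π≈ (binomialFactor a) (binomialFactor≈1 a) binomial→P N)))

-- Counting types

-- Pairs (k, π) with 2ᵏ |π| = n: the multiplicity 2ᵏ and the only nonempty
-- component of a type counted by A n.
dyadicPartitions : ℕ → Setoid 0ℓ 0ℓ
dyadicPartitions n = record
  { Carrier       = ∃ λ k → ∃ λ π → 2 ℕ.^ k ℕ.* size π ≡ n
  ; isEquivalence = On.isEquivalence (λ (k , π , _) → k , parts π)
                                     (Setoid.isEquivalence (≡.setoid (ℕ × List ℕ)))
  }

-- In this additive instance `Π` denotes a sum.
module Sumℕ = CommutativeMonoidProducts ℕ.+-0-commutativeMonoid

Σ-single : ∀ (f : ℕ → ℕ) {j K} → (∀ {i} → i ≢ j → f i ≡ 0) → j < K → Sumℕ.Π f K ≡ f j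
Σ-single f {j} {K} f≡0 j<K = begin
  Sumℕ.Π f K             ≡⟨ Sumℕ.Π-stable {F = f} j<K (λ i j<i → f≡0 {i} (ℕ.>⇒≢ j<i)) ⟩
  Sumℕ.Π f (suc j)       ≡⟨ Sumℕ.Π-last f j ⟩
  Sumℕ.Π f j ℕ.+ f j
    ≡⟨ cong (ℕ._+ f j) (Sumℕ.Π-cong {f} {λ _ → 0} j (λ {i} i<j → f≡0 {i} (ℕ.<⇒≢ i<j))) ⟩
  Sumℕ.Π (λ _ → 0) j ℕ.+ f j ≡⟨ cong (ℕ._+ f j) (Sumℕ.Π-ε {λ _ → 0} j (λ _ → refl)) ⟩
  f j                    ∎
  where open ≡-Reasoning

∅ : Partition
∅ = record { parts = [] ; decreasing = [] ; positive = [] }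

concentrated : ℕ → Partition → ℕ → Partition
concentrated j π m = if does (m ℕ.≟ j) then π else ∅

concentrated-on : ∀ j π → concentrated j π j ≡ π
concentrated-on j π = cong (if_then π else ∅) (dec-true (j ℕ.≟ j) refl)

concentrated-off : ∀ {j m} π → m ≢ j → concentrated j π m ≡ ∅
concentrated-off {j} {m} π m≢j = cong (if_then π else ∅) (dec-false (m ℕ.≟ j) m≢j)

size-parts : ∀ {π ρ} → parts π ≡ parts ρ → size π ≡ size ρ
size-parts = cong sum

component-off : ∀ {n} (τ : Type n) {j} → (∀ {i} → IsMultiplicity τ i → suc j ≡ i) →
                ∀ {m} → m ≢ j → parts (component τ m) ≡ []
-- Matching on the list turns "not nonempty" into an actual proof of emptiness.
component-off τ unique {m} m≢j with parts (component τ m) in eq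
... | []    = refl
... | x ∷ l = contradiction
  (sym (ℕ.suc-injective (unique (m , refl , λ empty → case trans (sym eq) empty of λ ()))))
  m≢j

total-single : ∀ {n} (τ : Type n) {j} → (∀ {i} → IsMultiplicity τ i → suc j ≡ i) →
               suc j ℕ.* size (component τ j) ≡ n
total-single τ {j} unique =
  -- The partial sum of length `max K (j + 1)` equals `n` and also contains the only term that can
  -- be nonzero.
  let (K , stable) = total τ in
  trans (sym (Σ-single (λ m → suc m ℕ.* size (component τ m))
                       (λ {m} m≢j →
                         trans (cong (suc m ℕ.*_) (size-parts {component τ m} {∅} (component-off τ unique m≢j)))
                               (ℕ.*-zeroʳ (suc m)))
                       (ℕ.m≤n⊔m K (suc j))))
        (stable (K ℕ.⊔ suc j) (ℕ.m≤m⊔n K (suc j)))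

2^-injective : ∀ {k l} → 2 ℕ.^ k ≡ 2 ℕ.^ l → k ≡ l
2^-injective {k} {l} eq = trans (sym (⌊log₂[2^n]⌋≡n k)) (trans (cong ⌊log₂_⌋ eq) (⌊log₂[2^n]⌋≡n l))

suc-pred-2^ : ∀ k → suc (ℕ.pred (2 ℕ.^ k)) ≡ 2 ℕ.^ k
suc-pred-2^ k = ℕ.suc-pred (2 ℕ.^ k) ⦃ ℕ.m^n≢0 2 k ⦄

strictInverse : ∀ {S T : Setoid 0ℓ 0ℓ} (f : Func S T) (g : Func T S) →
  (∀ y → Setoid._≈_ T (Func.to f (Func.to g y)) y) →
  (∀ x → Setoid._≈_ S (Func.to g (Func.to f x)) x) → Inverse S T
strictInverse {S} {T} f g f∘g≈id g∘f≈id = record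
  { to        = Func.to f
  ; from      = Func.to g
  ; to-cong   = Func.cong f
  ; from-cong = Func.cong g
  ; inverse   = strictlyInverseˡ⇒inverseˡ (Func.cong f) f∘g≈id
              , strictlyInverseʳ⇒inverseʳ (Func.cong g) g∘f≈id
  }
  where open Consequences S T

-- A type with the single multiplicity `2ᵏ` is determined by `k` and its component there. The bound
-- `1 ≤ n` makes that component nonempty on the way back.
types↔dyadicPartitions : ∀ {n} → 1 ≤ n →
  Inverse (singleMultiplicityPowerOf2Types n) (dyadicPartitions n)
types↔dyadicPartitions {n} 1≤n = strictInverse
  (record { to = to ; cong = λ {x} {y} → to-cong x y })
  (record { to = from ; cong = λ {x} {y} → from-cong x y })
  to∘from from∘to
  where
  module S = Setoid (singleMultiplicityPowerOf2Types n)
  module D = Setoid (dyadicPartitions n)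

  to : S.Carrier → D.Carrier
  to (τ , (_ , (j , refl , _) , unique) , k , i≡2^k) =
    k , component τ j , trans (cong (ℕ._* size (component τ j)) (sym i≡2^k)) (total-single τ unique)

  from : D.Carrier → S.Carrier
  from (k , π , 2^k∙π≡n) =
    -- Components are indexed from 0, so multiplicity `2ᵏ` sits at `j = 2ᵏ - 1`, and partial sums
    -- are constant from length `j + 1` on.
    record { component = concentrated j π ; total = suc j , λ _ → total-eq } ,
    (suc j , (j , refl , nonempty) , unique) , k , suc-pred-2^ k
    where
    j = ℕ.pred (2 ℕ.^ k)
    total-eq : ∀ {K} → j < K → Sumℕ.Π (λ m → suc m ℕ.* size (concentrated j π m)) K ≡ n
    total-eq {K} j<K = begin
      Sumℕ.Π (λ m → suc m ℕ.* size (concentrated j π m)) K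
        ≡⟨ Σ-single (λ m → suc m ℕ.* size (concentrated j π m))
             (λ {m} m≢j → trans (cong (λ ρ → suc m ℕ.* size ρ) (concentrated-off π m≢j))
                                (ℕ.*-zeroʳ (suc m))) j<K ⟩
      suc j ℕ.* size (concentrated j π j) ≡⟨ cong₂ ℕ._*_ (suc-pred-2^ k) (cong size (concentrated-on j π)) ⟩
      2 ℕ.^ k ℕ.* size π                  ≡⟨ 2^k∙π≡n ⟩
      n                                   ∎
      where open ≡-Reasoning
    nonempty : parts (concentrated j π j) ≢ []
    nonempty empty = ℕ.>⇒≢ 1≤n (trans (sym 2^k∙π≡n) (trans
      (cong (2 ℕ.^ k ℕ.*_) (size-parts {π} {∅} (trans (sym (cong parts (concentrated-on j π))) empty)))
      (ℕ.*-zeroʳ (2 ℕ.^ k))))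
    unique : ∀ {i} → (∃ λ m → i ≡ suc m × parts (concentrated j π m) ≢ []) → suc j ≡ i
    unique (m , refl , ne) with m ℕ.≟ j
    ... | yes refl = refl
    ... | no m≢j   = contradiction (cong parts (concentrated-off π m≢j)) ne

  to-cong : ∀ x y → x S.≈ y → to x D.≈ to y
  to-cong (τ , (_ , (j , refl , _) , unique) , k , i≡2^k)
          (σ , (_ , (l , refl , nonempty) , _) , k′ , i′≡2^k′) τ≈σ
    -- The multiplicity of `σ` is one of `τ` as well, so uniqueness identifies the two positions.
    with refl ← unique (l , refl , λ empty → nonempty (trans (sym (τ≈σ l)) empty))
    = cong₂ _,_ (2^-injective (trans (sym i≡2^k) i′≡2^k′)) (τ≈σ j)

  from-cong : ∀ x y → x D.≈ y → from x S.≈ from y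
  from-cong (k , π , _) (l , ρ , _) eq m =
    -- Moving `parts` inside the conditional leaves only data on which the setoid equality speaks.
    trans (if-float parts (does (m ℕ.≟ ℕ.pred (2 ℕ.^ k))))
      (trans (cong (λ (k , xs) → if does (m ℕ.≟ ℕ.pred (2 ℕ.^ k)) then xs else []) eq)
        (sym (if-float parts (does (m ℕ.≟ ℕ.pred (2 ℕ.^ l))))))

  to∘from : ∀ y → to (from y) D.≈ y
  to∘from (k , π , _) = cong (λ ρ → k , parts ρ) (concentrated-on (ℕ.pred (2 ℕ.^ k)) π)

  from∘to : ∀ x → from (to x) S.≈ x
  from∘to (τ , (_ , (j , refl , _) , unique) , k , i≡2^k) m
    -- Replacing `2ᵏ` by `suc j` lets its predecessor reduce to `j`.
    rewrite sym i≡2^k with m ℕ.≟ j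
  ... | yes refl = cong parts (concentrated-on j (component τ j))
  ... | no m≢j   = trans (cong parts (concentrated-off (component τ j) m≢j))
                         (sym (component-off τ unique m≢j))

-- Dyadic partitions of odd and even numbers.

dyadicPartitions-odd : ∀ m → Inverse (dyadicPartitions (suc (2 ℕ.* m))) (partitionsOf (suc (2 ℕ.* m)))
dyadicPartitions-odd m = strictInverse
  (record { to = to ; cong = λ {x} {y} → to-cong x y })
  (record { to = λ (π , eq) → 0 , π , trans (ℕ.*-identityˡ (size π)) eq ; cong = cong (λ xs → 0 , xs) })
  (λ _ → refl) from∘to
  where
  module D = Setoid (dyadicPartitions (suc (2 ℕ.* m)))
  module P = Setoid (partitionsOf (suc (2 ℕ.* m)))
  -- This excludes every `k ≥ 1`, leaving only the partitions of the odd number itself.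
  not-even : ∀ k s → 2 ℕ.^ suc k ℕ.* s ≢ suc (2 ℕ.* m)
  not-even k s eq = ℕ.even≢odd (2 ℕ.^ k ℕ.* s) m (trans (sym (ℕ.*-assoc 2 (2 ℕ.^ k) s)) eq)
  to : D.Carrier → P.Carrier
  to (zero  , π , eq) = π , trans (sym (ℕ.*-identityˡ (size π))) eq
  to (suc k , π , eq) = contradiction eq (not-even k (size π))
  to-cong : ∀ x y → x D.≈ y → to x P.≈ to y
  to-cong (zero  , _ , _)  (zero  , _ , _)  eq = cong proj₂ eq
  to-cong (suc k , π , e)  _                eq = contradiction e (not-even k (size π))
  to-cong _                (suc k , π , e)  eq = contradiction e (not-even k (size π))
  from∘to : ∀ x → (0 , parts (proj₁ (to x))) ≡ (proj₁ x , parts (proj₁ (proj₂ x)))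
  from∘to (zero  , _ , _) = refl
  from∘to (suc k , π , e) = contradiction e (not-even k (size π))

-- The summands correspond to `k = 0` and `k ≥ 1`; in the second case the equation is divided by 2.
dyadicPartitions-even : ∀ m →
  Inverse (dyadicPartitions (2 ℕ.* m)) (partitionsOf (2 ℕ.* m) ⊎ₛ dyadicPartitions m)
dyadicPartitions-even m = strictInverse
  (record { to = to ; cong = λ {x} {y} → to-cong x y })
  (record { to = from ; cong = from-cong })
  to∘from from∘to
  where
  module D = Setoid (dyadicPartitions (2 ℕ.* m))
  module P = Setoid (partitionsOf (2 ℕ.* m) ⊎ₛ dyadicPartitions m)
  to : D.Carrier → P.Carrier
  to (zero  , π , eq) = inj₁ (π , trans (sym (ℕ.*-identityˡ (size π))) eq)
  to (suc k , π , eq) = inj₂ (k , π ,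
    ℕ.*-cancelˡ-≡ _ m 2 (trans (sym (ℕ.*-assoc 2 (2 ℕ.^ k) (size π))) eq))
  from : P.Carrier → D.Carrier
  from (inj₁ (π , eq))     = 0 , π , trans (ℕ.*-identityˡ (size π)) eq
  from (inj₂ (k , π , eq)) = suc k , π , trans (ℕ.*-assoc 2 (2 ℕ.^ k) (size π)) (cong (2 ℕ.*_) eq)
  to-cong : ∀ x y → x D.≈ y → to x P.≈ to y
  to-cong (zero  , _ , _) (zero  , _ , _) eq = inj₁ (cong proj₂ eq)
  to-cong (suc _ , _ , _) (suc _ , _ , _) eq = inj₂ (cong (λ (k , xs) → ℕ.pred k , xs) eq)
  from-cong : ∀ {x y} → x P.≈ y → from x D.≈ from y
  from-cong (inj₁ eq) = cong (λ xs → 0 , xs) eq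
  from-cong (inj₂ eq) = cong (λ (k , xs) → suc k , xs) eq
  to∘from : ∀ y → to (from y) P.≈ y
  to∘from (inj₁ _) = inj₁ refl
  to∘from (inj₂ _) = inj₂ refl
  from∘to : ∀ x → from (to x) D.≈ x
  from∘to (zero  , _ , _) = refl
  from∘to (suc _ , _ , _) = refl

-- From bijections to the recursion for `A`.

cardinality-unique : ∀ {S T m n} → Inverse S T → S HasCardinality m → T HasCardinality n → m ≡ n
cardinality-unique S↔T S↔m T↔n = ↔⇒≡ (↔-trans (↔-sym S↔m) (↔-trans S↔T T↔n))

⊎-cardinality : ∀ {S T m n} → S HasCardinality m → T HasCardinality n →
                (S ⊎ₛ T) HasCardinality (m ℕ.+ n)
⊎-cardinality S↔m T↔n = ↔-trans (S↔m ⊎-inverse T↔n) (↔-trans (Pointwise-≡↔≡ _ _) (↔-sym +↔⊎))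

module _
  (p A : ℕ → ℕ)
  (p-card : ∀ n → partitionsOf n HasCardinality p n)
  (A-card : ∀ n → 1 ≤ n → singleMultiplicityPowerOf2Types n HasCardinality A n)
  where

  dyadic-card : ∀ n → dyadicPartitions (suc n) HasCardinality A (suc n)
  dyadic-card n = ↔-trans (↔-sym (types↔dyadicPartitions (s≤s z≤n))) (A-card (suc n) (s≤s z≤n))

  A-odd : ∀ i → A (suc (2 ℕ.* i)) ≡ p (suc (2 ℕ.* i))
  A-odd i = cardinality-unique (dyadicPartitions-odd i) (dyadic-card (2 ℕ.* i)) (p-card _)

  A-even : ∀ i → A (2 ℕ.+ 2 ℕ.* i) ≡ p (2 ℕ.+ 2 ℕ.* i) ℕ.+ A (suc i)
  A-even i = cardinality-unique doubling (dyadic-card _) (⊎-cardinality (p-card _) (dyadic-card i))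
    where
    doubling : Inverse (dyadicPartitions (2 ℕ.+ 2 ℕ.* i))
                       (partitionsOf (2 ℕ.+ 2 ℕ.* i) ⊎ₛ dyadicPartitions (suc i))
    doubling = subst (λ n → Inverse (dyadicPartitions n) (partitionsOf n ⊎ₛ dyadicPartitions (suc i)))
                     (ℕ.*-suc 2 i) (dyadicPartitions-even (suc i))

proposition58 : (p A : ℕ → ℕ) →
    (∀ n → partitionsOf n HasCardinality p n) →
    (∀ n → 1 ≤ n → singleMultiplicityPowerOf2Types n HasCardinality A n) →
    (∃ λ (a : ℕ → ℤ) → ProductIdentity p a) ×
    (∀ (a : ℕ → ℤ) → ProductIdentity p a → ∀ n → 1 ≤ n → + A n ≡ a n)
proposition58 p A p-card A-card =
  -- Existence is witnessed by `A` itself; comparing any other solution with it gives uniqueness at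
  -- positive indices.
  (+_ ∘ A , productIdentity) , λ { a identity (suc n) _ → productIdentity-unique a identity n }
  where open DoublingIdentity p A (A-odd p A p-card A-card) (A-even p A p-card A-card)
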